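{- Let $p,q>1$ be coprime integers and let $m\ge 1$ be an integer. Then $$B_m=\frac{m}{p^m-1}\,\sigma_{m-1}(p,q)+\frac{q^m}{p(1-p^m)}\sum_{r=0}^{m-1}\binom{m}{r}\Big(\frac{p}{q}\Big)^r B_r\,S_{m-r}(p).$$
   Context: The Bernoulli numbers $B_n$ are defined by $\frac{z}{e^z-1}=\sum_{n=0}^{\infty}B_n\frac{z^n}{n!}$ for $|z|<2\pi$ (so $B_1=-1/2$). For $j\ge 1$, $S_j(n)=\sum_{k=0}^{n-1}k^j$. For $k\ge 0$, the Sylvester sum is $\sigma_k(p,q)=\sum_{s\notin S(p,q)}s^k$, where $S(p,q)=\{ap+bq: a,b\in\mathbb{Z}_{\ge 0}\}$ and the sum is over the finitely many non-negative integers $s$ not in $S(p,q)$. -}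

module Defs where

open import Algebra.Bundles using (CommutativeRing)
open import Data.Fin.Base using (Fin; zero; suc; toℕ)
open import Data.Integer.Base as ℤ using (+_)
import Data.Integer.Properties as ℤ
open import Data.List.Base using (List; filter; map; upTo)
open import Data.List.Membership.Propositional using () renaming (_∈_ to _∈ₗ_)
open import Data.List.Membership.Propositional.Properties using (∈-filter⁺; ∈-filter⁻; ∈-upTo⁺)
open import Data.List.Relation.Unary.Unique.Propositional using (Unique)
open import Data.List.Relation.Unary.Unique.Propositional.Properties using (filter⁺; upTo⁺)
open import Data.Nat.Base as ℕ using (ℕ; zero; suc; _∸_; _!)
open import Data.Nat.Coprimality using (Coprime; coprime-Bézout)
open import Data.Nat.DivMod using (_%_; m≡m%n+[m/n]*n; m%n<n) renaming (_/_ to _ℕ/_)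
open import Data.Nat.Divisibility using (_∣_; divides; divides-refl; _∣?_; ∣m+n∣m⇒∣n)
open import Data.Nat.GCD using (module Bézout)
open import Data.Nat.ListAction using (sum)
import Data.Nat.Properties as ℕ
open import Data.Nat.Tactic.RingSolver using (solve-∀)
open import Data.Product.Base using (∃; ∃₂; _×_; _,_; proj₁; proj₂)
open import Data.Rational.Base hiding (∣_∣)
open import Data.Rational.Properties
open import Data.Rational.Unnormalised.Base as ℚᵘ using (mkℚᵘ)
import Data.Rational.Unnormalised.Properties as ℚᵘ
open import Data.Vec.Base using (Vec; []; _∷_; lookup)
open import Function.Bundles using (_⇔_; mk⇔)
open import Level using (0ℓ)
open import Relation.Binary.PropositionalEquality
open import Relation.Nullary using (¬?)
open import Relation.Nullary.Decidable using (map′; _×-dec_)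
open import Relation.Unary using (Pred; Decidable; _∈_; _∉_)

private
  module ℚ-semiring = CommutativeRing +-*-commutativeRing using (semiring)

open import Algebra.Properties.Semiring.Exp ℚ-semiring.semiring public
  using (_^_)
open import Algebra.Properties.Semiring.Sum ℚ-semiring.semiring public
  using (sum-syntax; sum⁺-syntax; sum-cong-≗)

ι : ℕ → ℚ
ι n = + n / 1

ι-pos : ∀ n .{{_ : ℕ.NonZero n}} → Positive (ι n)
ι-pos n = normalize-pos n 1

ι-nonZero : ∀ n .{{_ : ℕ.NonZero n}} → NonZero (ι n)
ι-nonZero n = pos⇒nonZero (ι n) {{ι-pos n}}

-- A formal power series is its sequence of coefficients; the argument is the
-- exponent of z.
PowerSeries : Set
PowerSeries = ℕ → ℚ

infixl 7 _⊛_

_⊛_ : PowerSeries → PowerSeries → PowerSeries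
(f ⊛ g) n = ∑[ i ≤ n ] (f (toℕ i) * g (n ∸ toℕ i))

-- Σₙ aₙ zⁿ / n!
egf : (ℕ → ℚ) → PowerSeries
egf a n = (a n ÷ ι (n !)) {{ι-nonZero (n !) {{n ℕ.!≢0}}}}

Z : PowerSeries
Z 1 = 1ℚ
Z _ = 0ℚ

-- e^z - 1
exp-1 : PowerSeries
exp-1 = egf λ { zero → 0ℚ ; (suc _) → 1ℚ }

-- The coefficients h of z / (e^z - 1), computed by comparing coefficients of
-- z^(n+1) in (e^z - 1) h = z:  hₙ = [n = 0] - Σ_{i<n} h_{n-1-i} / (i+2)!.
-- quotients n lists h_{n-1}, …, h₀ in this order.

quotients : (n : ℕ) → Vec ℚ n
quotient  : PowerSeries

quotients zero    = []
quotients (suc n) = quotient n ∷ quotients n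

quotient n = Z (suc n) - ∑[ i < n ] (exp-1 (2 ℕ.+ toℕ i) * lookup (quotients n) i)

bernoulli : ℕ → ℚ
bernoulli n = ι (n !) * quotient n

private
  lookup-quotients : ∀ n (i : Fin n) → lookup (quotients n) i ≡ quotient (n ∸ suc (toℕ i))
  lookup-quotients (suc n) zero    = refl
  lookup-quotients (suc n) (suc i) = lookup-quotients n i

  egf-bernoulli : ∀ n → egf bernoulli n ≡ quotient n
  egf-bernoulli n = begin
    ι (n !) * quotient n * 1/ ι (n !)   ≡⟨ cong (_* 1/ ι (n !)) (*-comm (ι (n !)) (quotient n)) ⟩
    quotient n * ι (n !) * 1/ ι (n !)   ≡⟨ *-assoc (quotient n) (ι (n !)) (1/ ι (n !)) ⟩
    quotient n * (ι (n !) * 1/ ι (n !)) ≡⟨ cong (quotient n *_) (*-inverseʳ (ι (n !))) ⟩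
    quotient n * 1ℚ                     ≡⟨ *-identityʳ (quotient n) ⟩
    quotient n                          ∎
    where
    open ≡-Reasoning
    instance _ = ι-nonZero (n !) {{n ℕ.!≢0}}

  exp-1-⊛-quotient : (exp-1 ⊛ quotient) ≗ Z
  exp-1-⊛-quotient zero    = refl
  exp-1-⊛-quotient (suc n) = begin
    0ℚ * quotient (suc n) + (1ℚ * quotient n + tail)
      ≡⟨ cong₂ _+_ (*-zeroˡ (quotient (suc n))) (cong (λ x → x + tail) (*-identityˡ (quotient n))) ⟩
    0ℚ + (quotient n + tail)
      ≡⟨ +-identityˡ (quotient n + tail) ⟩
    quotient n + tail
      ≡⟨ cong (λ x → quotient n + x) (sum-cong-≗ {n} λ i →
           cong (exp-1 (2 ℕ.+ toℕ i) *_) (sym (lookup-quotients n i))) ⟩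
    (Z (suc n) - tail′) + tail′
      ≡⟨ +-assoc (Z (suc n)) (- tail′) tail′ ⟩
    Z (suc n) + (- tail′ + tail′)
      ≡⟨ cong (λ x → Z (suc n) + x) (+-inverseˡ tail′) ⟩
    Z (suc n) + 0ℚ
      ≡⟨ +-identityʳ (Z (suc n)) ⟩
    Z (suc n) ∎
    where
    open ≡-Reasoning
    tail  = ∑[ i < n ] (exp-1 (2 ℕ.+ toℕ i) * quotient (n ∸ suc (toℕ i)))
    tail′ = ∑[ i < n ] (exp-1 (2 ℕ.+ toℕ i) * lookup (quotients n) i)

-- (e^z - 1) · Σₙ Bₙ zⁿ / n! = z, which determines B since e^z - 1 ≠ 0.
bernoulli-egf : (exp-1 ⊛ egf bernoulli) ≗ Z
bernoulli-egf n = trans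
  (sum-cong-≗ {suc n} λ i → cong (exp-1 (toℕ i) *_) (egf-bernoulli (n ∸ toℕ i)))
  (exp-1-⊛-quotient n)

-- S_j(n)
powerSum : ℕ → ℕ → ℕ
powerSum j n = sum (map (ℕ._^ j) (upTo n))

-- S(p,q)
⟨_,_⟩ : ℕ → ℕ → Pred ℕ 0ℓ
⟨ p , q ⟩ s = ∃₂ λ a b → s ≡ a ℕ.* p ℕ.+ b ℕ.* q

⟨_,_⟩? : ∀ p q → Decidable ⟨ p , q ⟩
⟨ p , q ⟩? s = map′ to from (ℕ.anyUpTo? (λ x → p ∣? x ×-dec q ∣? (s ∸ x)) (suc s))
  where
  P : ℕ → Set
  P x = p ∣ x × q ∣ (s ∸ x)

  to : (∃ λ x → x ℕ.< suc s × P x) → s ∈ ⟨ p , q ⟩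
  to (x , x<1+s , divides a x≡ap , divides b s∸x≡bq) =
    a , b , trans (sym (ℕ.m+[n∸m]≡n (ℕ.≤-pred x<1+s))) (cong₂ ℕ._+_ x≡ap s∸x≡bq)

  from : s ∈ ⟨ p , q ⟩ → ∃ λ x → x ℕ.< suc s × P x
  from (a , b , refl) =
    a ℕ.* p , ℕ.s≤s (ℕ.m≤m+n (a ℕ.* p) (b ℕ.* q)) , divides-refl a , divides b (ℕ.m+n∸m≡n (a ℕ.* p) (b ℕ.* q))

-- The elements of ℕ ∖ S(p,q). For coprime p, q ≥ 1 they are all below pq (see
-- ∈-gaps), so that the truncation at pq omits none.
gaps : ℕ → ℕ → List ℕ
gaps p q = filter (λ s → ¬? (⟨ p , q ⟩? s)) (upTo (p ℕ.* q))

-- σₖ(p,q)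
sylvesterSum : ℕ → ℕ → ℕ → ℕ
sylvesterSum k p q = sum (map (ℕ._^ k) (gaps p q))

gaps-unique : ∀ p q → Unique (gaps p q)
gaps-unique p q = filter⁺ (λ s → ¬? (⟨ p , q ⟩? s)) (upTo⁺ (p ℕ.* q))

private
  swap : ∀ {p q s} → s ∈ ⟨ p , q ⟩ → s ∈ ⟨ q , p ⟩
  swap {p} {q} (a , b , eq) = b , a , trans eq (ℕ.+-comm (a ℕ.* p) (b ℕ.* q))

  -- With a = s x mod q we have a p ≡ s (mod q) and a p ≤ q p ≤ s.
  bézout⇒∈ : ∀ p q .{{_ : ℕ.NonZero q}} x y → 1 ℕ.+ y ℕ.* q ≡ x ℕ.* p →
             ∀ s → q ℕ.* p ℕ.≤ s → s ∈ ⟨ p , q ⟩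
  bézout⇒∈ p q x y eq s qp≤s = a , b , trans (sym (ℕ.m+[n∸m]≡n ap≤s)) (cong (a ℕ.* p ℕ.+_) s∸ap≡bq)
    where
    a = (s ℕ.* x) % q
    c = (s ℕ.* x) ℕ/ q

    ap≤s : a ℕ.* p ℕ.≤ s
    ap≤s = ℕ.≤-trans (ℕ.*-monoˡ-≤ p (ℕ.<⇒≤ (m%n<n (s ℕ.* x) q))) qp≤s

    open ≡-Reasoning

    cpq≡ : (c ℕ.* p) ℕ.* q ≡ (s ℕ.* y) ℕ.* q ℕ.+ (s ∸ a ℕ.* p)
    cpq≡ = ℕ.+-cancelˡ-≡ (a ℕ.* p) _ _ (begin
      a ℕ.* p ℕ.+ (c ℕ.* p) ℕ.* q
        ≡⟨ lemma₁ a c p q ⟩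
      (a ℕ.+ c ℕ.* q) ℕ.* p
        ≡⟨ cong (ℕ._* p) (m≡m%n+[m/n]*n (s ℕ.* x) q) ⟨
      (s ℕ.* x) ℕ.* p
        ≡⟨ ℕ.*-assoc s x p ⟩
      s ℕ.* (x ℕ.* p)
        ≡⟨ cong (s ℕ.*_) eq ⟨
      s ℕ.* (1 ℕ.+ y ℕ.* q)
        ≡⟨ lemma₂ s y q ⟩
      (s ℕ.* y) ℕ.* q ℕ.+ s
        ≡⟨ cong ((s ℕ.* y) ℕ.* q ℕ.+_) (ℕ.m+[n∸m]≡n ap≤s) ⟨
      (s ℕ.* y) ℕ.* q ℕ.+ (a ℕ.* p ℕ.+ (s ∸ a ℕ.* p))
        ≡⟨ lemma₃ ((s ℕ.* y) ℕ.* q) (a ℕ.* p) (s ∸ a ℕ.* p) ⟩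
      a ℕ.* p ℕ.+ ((s ℕ.* y) ℕ.* q ℕ.+ (s ∸ a ℕ.* p))
        ∎)
      where
      lemma₁ : ∀ a c p q → a ℕ.* p ℕ.+ (c ℕ.* p) ℕ.* q ≡ (a ℕ.+ c ℕ.* q) ℕ.* p
      lemma₁ = solve-∀
      lemma₂ : ∀ s y q → s ℕ.* (1 ℕ.+ y ℕ.* q) ≡ (s ℕ.* y) ℕ.* q ℕ.+ s
      lemma₂ = solve-∀
      lemma₃ : ∀ u v w → u ℕ.+ (v ℕ.+ w) ≡ v ℕ.+ (u ℕ.+ w)
      lemma₃ = solve-∀

    q∣ : q ∣ (s ∸ a ℕ.* p)
    q∣ = ∣m+n∣m⇒∣n (divides (c ℕ.* p) (sym cpq≡)) (divides-refl (s ℕ.* y))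

    b = _∣_.quotient q∣
    s∸ap≡bq = _∣_.equality q∣

pq≤⇒∈ : ∀ p q .{{_ : ℕ.NonZero p}} .{{_ : ℕ.NonZero q}} → Coprime p q →
        ∀ s → p ℕ.* q ℕ.≤ s → s ∈ ⟨ p , q ⟩
pq≤⇒∈ p q coprime s pq≤s with coprime-Bézout coprime
... | Bézout.+- x y eq = bézout⇒∈ p q x y eq s (subst (ℕ._≤ s) (ℕ.*-comm p q) pq≤s)
... | Bézout.-+ x y eq = swap (bézout⇒∈ q p y x eq s pq≤s)

∈-gaps : ∀ p q .{{_ : ℕ.NonZero p}} .{{_ : ℕ.NonZero q}} → Coprime p q →
         ∀ s → s ∈ₗ gaps p q ⇔ s ∉ ⟨ p , q ⟩
∈-gaps p q coprime s = mk⇔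
  (λ s∈ → proj₂ (∈-filter⁻ (λ s → ¬? (⟨ p , q ⟩? s)) {xs = upTo (p ℕ.* q)} s∈))
  (λ s∉ → ∈-filter⁺ (λ s → ¬? (⟨ p , q ⟩? s))
    (∈-upTo⁺ (ℕ.≰⇒> λ pq≤s → s∉ (pq≤⇒∈ p q coprime s pq≤s))) s∉)

private
  ι-mono-< : ∀ {m n} → m ℕ.< n → ι m < ι n
  ι-mono-< {m} {n} m<n = toℚᵘ-cancel-< (ℚᵘ.<-respˡ-≃ (ℚᵘ.≃-sym (toℚᵘ-fromℚᵘ (mkℚᵘ (+ m) 0)))
    (ℚᵘ.<-respʳ-≃ (ℚᵘ.≃-sym (toℚᵘ-fromℚᵘ (mkℚᵘ (+ n) 0)))
      (ℚᵘ.*<* (ℤ.*-monoʳ-<-pos (+ 1) (ℤ.+<+ m<n)))))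

  1<x^m : ∀ {x} → 1ℚ < x → ∀ m → 1 ℕ.≤ m → 1ℚ < x ^ m
  1<x^m {x} 1<x 1             _ = subst (1ℚ <_) (sym (*-identityʳ x)) 1<x
  1<x^m {x} 1<x (suc (suc m)) _ = <-trans 1<x
    (subst (_< x * x ^ suc m) (*-identityʳ x)
      (*-monoʳ-<-pos x {{positive (<-trans (ι-mono-< {0} {1} (ℕ.s≤s ℕ.z≤n)) 1<x)}}
        (1<x^m 1<x (suc m) (ℕ.s≤s ℕ.z≤n))))

  1<p^m : ∀ {p m} → 1 ℕ.< p → 1 ℕ.≤ m → 1ℚ < ι p ^ m
  1<p^m {p} {m} 1<p = 1<x^m (ι-mono-< 1<p) m

p^m-1-nonZero : ∀ {p m} → 1 ℕ.< p → 1 ℕ.≤ m → NonZero (ι p ^ m - 1ℚ)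
p^m-1-nonZero {p} {m} 1<p 1≤m = >-nonZero
  (subst (_< ι p ^ m - 1ℚ) (+-inverseʳ 1ℚ) (+-monoˡ-< (- 1ℚ) (1<p^m 1<p 1≤m)))

p[1-p^m]-nonZero : ∀ {p m} → 1 ℕ.< p → 1 ℕ.≤ m → NonZero (ι p * (1ℚ - ι p ^ m))
p[1-p^m]-nonZero {p} {m} 1<p 1≤m = neg⇒nonZero (ι p * (1ℚ - ι p ^ m)) {{pos*neg⇒neg (ι p) (1ℚ - ι p ^ m)}}
  where
  instance
    _ = ι-pos p {{ℕ.>-nonZero (ℕ.<-trans (ℕ.s≤s ℕ.z≤n) 1<p)}}
    _ = negative (subst (1ℚ - ι p ^ m <_) (+-inverseʳ (ι p ^ m))
          (+-monoˡ-< (- (ι p ^ m)) (1<p^m 1<p 1≤m)))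

1<n⇒ι-nonZero : ∀ {n} → 1 ℕ.< n → NonZero (ι n)
1<n⇒ι-nonZero {n} 1<n = ι-nonZero n {{ℕ.>-nonZero (ℕ.<-trans (ℕ.s≤s ℕ.z≤n) 1<n)}}

{-# OPTIONS --safe #-}

-- Let β(z) = z/(e^z - 1). Every residue class mod p meets S(p,q) in
-- kq, kq + p, kq + 2p, … for a unique k < p, whence
--   (x^p - 1) Σ_{s ∉ S(p,q)} x^s = Σ_{k<p} x^{kq} - Σ_{c<p} x^c.
-- Put x = e^z and multiply by β(pz) = pz/(e^{pz} - 1). As
-- β(pz) Σ_{c<p} e^{cz} = p β(z), this gives
--   pz Σ_{s ∉ S(p,q)} e^{sz} + p β(z) = β(pz) Σ_{k<p} e^{kqz},
-- and the theorem follows by comparing the coefficients of z^m, where the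
-- summand r = m on the right is p^{m+1} B_m.
module Submission where

open import Defs
open import Algebra.Bundles using (CommutativeRing)
open import Data.Fin.Base using (Fin; toℕ; fromℕ; inject₁)
import Data.Fin.Properties as Fin
import Data.Integer.Base as ℤ
import Data.Integer.Properties as ℤ
open import Data.List.Base using (List; []; _∷_; _++_; foldr; map; upTo)
open import Data.List.Membership.Propositional using (_∈_)
open import Data.List.Membership.Propositional.Properties
  using (∈-++⁺ˡ; ∈-++⁺ʳ; ∈-++⁻; ∈-map⁺; ∈-map⁻; ∈-upTo⁺; ∈-upTo⁻)
open import Data.List.Membership.Propositional.Properties.WithK using (unique∧set⇒bag)
open import Data.List.Properties using (upTo-∷ʳ)
open import Data.List.Relation.Binary.BagAndSetEquality using (∼bag⇒↭)
open import Data.List.Relation.Binary.Permutation.Propositional as Perm using (_↭_)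
open import Data.List.Relation.Unary.Unique.Propositional using (Unique)
open import Data.List.Relation.Unary.Unique.Propositional.Properties using (++⁺; map⁺; upTo⁺)
open import Data.Nat.Base as ℕ using (ℕ; zero; suc; _<_; _≤_; _∸_; _!; z≤n; s≤s)
open import Data.Nat.Combinatorics using (_C_; nCk≡n!/k![n-k]!; k![n∸k]!∣n!; nCn≡1)
open import Data.Nat.Coprimality using (Coprime; coprime-divisor)
open import Data.Nat.Divisibility using (_∣_; divides; >⇒∤)
open import Data.Nat.DivMod using (m/n*n≡m)
import Data.Nat.ListAction as ℕ using (sum)
import Data.Nat.Properties as ℕ
import Data.Nat.Tactic.RingSolver as ℕ using (solve-∀)
open import Data.Product.Base using (∃; _×_; _,_)
open import Data.Rational.Base using (ℚ; _+_; _*_; _-_; _÷_; 1/_; 0ℚ; 1ℚ; NonZero)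
open import Data.Rational.Properties
  using ( _≟_; +-*-commutativeRing; +-0-group; +-assoc; +-comm; +-identityˡ; +-identityʳ
        ; *-assoc; *-comm; *-identityˡ; *-identityʳ; *-zeroˡ; *-zeroʳ; *-inverseˡ
        ; *-distribˡ-+; *-distribʳ-+; toℚᵘ-injective; toℚᵘ-fromℚᵘ; toℚᵘ-homo-+)
import Data.Rational.Unnormalised.Base as ℚᵘ
import Data.Rational.Unnormalised.Properties as ℚᵘ
open import Data.Sum.Base using (_⊎_; inj₁; inj₂)
open import Function.Base using (_∘_)
open import Function.Bundles using (mk⇔; Equivalence)
open import Relation.Binary.PropositionalEquality
open import Relation.Nullary using (¬_; yes; no; contradiction)
open import Relation.Nullary.Decidable using (dec⇒maybe)
open import Tactic.RingSolver using (solve-∀)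
open import Tactic.RingSolver.Core.AlmostCommutativeRing using (AlmostCommutativeRing; fromCommutativeRing)

private
  module ℚ-CR = CommutativeRing +-*-commutativeRing using (semiring; commutativeSemiring)

open import Algebra.Properties.CommutativeSemiring.Binomial ℚ-CR.commutativeSemiring
  using () renaming (theorem to binomial-theorem)
open import Algebra.Properties.CommutativeSemiring.Exp ℚ-CR.commutativeSemiring
  using (^-distrib-*; ^-homo-*)
open import Algebra.Properties.Group +-0-group using () renaming (∙-cancelˡ to +-cancelˡ)
open import Algebra.Properties.Semiring.Mult ℚ-CR.semiring using () renaming (_×_ to _·_)
open import Algebra.Properties.Semiring.Sum ℚ-CR.semiring
  using (*-distribˡ-sum; *-distribʳ-sum; ∑-distrib-+; sum-init-last; sum-replicate-zero)

open ≡-Reasoning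

-- The embedding of ℕ in ℚ

ℚ-ring : AlmostCommutativeRing _ _
ℚ-ring = fromCommutativeRing +-*-commutativeRing (λ x → dec⇒maybe (0ℚ ≟ x))

-- `ι` normalises its fraction, so the equation is moved to unnormalised rationals, where all
-- denominators are 1 and an identity of integers remains.
ι-homo-+ : ∀ m n → ι (m ℕ.+ n) ≡ ι m + ι n
ι-homo-+ m n = toℚᵘ-injective (ℚᵘ.≃-trans (toℚᵘ-fromℚᵘ (ℚᵘ.mkℚᵘ (ℤ.+ (m ℕ.+ n)) 0))
  (ℚᵘ.≃-trans (ℚᵘ.*≡* (cong (ℤ._* ℤ.+ 1) (sym (cong₂ ℤ._+_ (ℤ.*-identityʳ (ℤ.+ m)) (ℤ.*-identityʳ (ℤ.+ n))))))
  (ℚᵘ.≃-sym (ℚᵘ.≃-trans (toℚᵘ-homo-+ (ι m) (ι n))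
    (ℚᵘ.+-cong (toℚᵘ-fromℚᵘ (ℚᵘ.mkℚᵘ (ℤ.+ m) 0)) (toℚᵘ-fromℚᵘ (ℚᵘ.mkℚᵘ (ℤ.+ n) 0)))))))

ι-suc : ∀ n → ι (suc n) ≡ ι n + 1ℚ
ι-suc n = trans (ι-homo-+ 1 n) (+-comm 1ℚ (ι n))

ι-suc-* : ∀ n x → ι (suc n) * x ≡ x + ι n * x
ι-suc-* n x = trans (cong (_* x) (ι-suc n)) (lemma x (ι n))
  where
  lemma : ∀ x y → (y + 1ℚ) * x ≡ x + y * x
  lemma = solve-∀ ℚ-ring

ι-homo-* : ∀ m n → ι (m ℕ.* n) ≡ ι m * ι n
ι-homo-* zero    n = sym (*-zeroˡ (ι n))
ι-homo-* (suc m) n = begin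
  ι (n ℕ.+ m ℕ.* n)    ≡⟨ ι-homo-+ n (m ℕ.* n) ⟩
  ι n + ι (m ℕ.* n)    ≡⟨ cong (ι n +_) (ι-homo-* m n) ⟩
  ι n + ι m * ι n      ≡⟨ ι-suc-* m (ι n) ⟨
  ι (suc m) * ι n      ∎

ι-homo-^ : ∀ m n → ι (m ℕ.^ n) ≡ ι m ^ n
ι-homo-^ m zero    = refl
ι-homo-^ m (suc n) = trans (ι-homo-* m (m ℕ.^ n)) (cong (ι m *_) (ι-homo-^ m n))

·-ι : ∀ n x → n · x ≡ ι n * x
·-ι zero    x = sym (*-zeroˡ x)
·-ι (suc n) x = trans (cong (x +_) (·-ι n x)) (sym (ι-suc-* n x))

^-split : ∀ x {m n} → m ≤ n → x ^ m * x ^ (n ∸ m) ≡ x ^ n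
^-split x {m} {n} m≤n = trans (sym (^-homo-* x m (n ∸ m))) (cong (x ^_) (ℕ.m+[n∸m]≡n m≤n))

-- The algebra of power series

⊛-congˡ : ∀ f {g g′} → g ≗ g′ → (f ⊛ g) ≗ (f ⊛ g′)
⊛-congˡ f g≗g′ n = sum-cong-≗ {suc n} λ i → cong (f (toℕ i) *_) (g≗g′ (n ∸ toℕ i))

⊛-congʳ : ∀ g {f f′} → f ≗ f′ → (f ⊛ g) ≗ (f′ ⊛ g)
⊛-congʳ g f≗f′ n = sum-cong-≗ {suc n} λ i → cong (_* g (n ∸ toℕ i)) (f≗f′ (toℕ i))

-- By computation `⊛` splits off the summand with `f 0`; this is the mirror rule, at the other end
-- of the sum. Comparing the two yields commutativity.
⊛-sucʳ : ∀ f g n → (f ⊛ g) (suc n) ≡ f (suc n) * g 0 + (f ⊛ (g ∘ suc)) n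
⊛-sucʳ f g zero    = lemma (f 0 * g 1) (f 1 * g 0)
  where
  lemma : ∀ x y → x + (y + 0ℚ) ≡ y + (x + 0ℚ)
  lemma = solve-∀ ℚ-ring
⊛-sucʳ f g (suc n) = begin
  f 0 * g (2 ℕ.+ n) + ((f ∘ suc) ⊛ g) (suc n)
    ≡⟨ cong (f 0 * g (2 ℕ.+ n) +_) (⊛-sucʳ (f ∘ suc) g n) ⟩
  f 0 * g (2 ℕ.+ n) + (f (2 ℕ.+ n) * g 0 + ((f ∘ suc) ⊛ (g ∘ suc)) n)
    ≡⟨ lemma (f 0 * g (2 ℕ.+ n)) (f (2 ℕ.+ n) * g 0) (((f ∘ suc) ⊛ (g ∘ suc)) n) ⟩
  f (2 ℕ.+ n) * g 0 + (f ⊛ (g ∘ suc)) (suc n) ∎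
  where
  lemma : ∀ x y z → x + (y + z) ≡ y + (x + z)
  lemma = solve-∀ ℚ-ring

⊛-comm : ∀ f g → (f ⊛ g) ≗ (g ⊛ f)
⊛-comm f g zero    = cong (_+ 0ℚ) (*-comm (f 0) (g 0))
⊛-comm f g (suc n) = begin
  f 0 * g (suc n) + ((f ∘ suc) ⊛ g) n ≡⟨ cong₂ _+_ (*-comm (f 0) (g (suc n))) (⊛-comm (f ∘ suc) g n) ⟩
  g (suc n) * f 0 + (g ⊛ (f ∘ suc)) n ≡⟨ ⊛-sucʳ g f n ⟨
  (g ⊛ f) (suc n)                     ∎

⊛-distribʳ-+ : ∀ f g h n → ((λ k → f k + g k) ⊛ h) n ≡ (f ⊛ h) n + (g ⊛ h) n
⊛-distribʳ-+ f g h n = trans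
  (sum-cong-≗ {suc n} λ i → *-distribʳ-+ (h (n ∸ toℕ i)) (f (toℕ i)) (g (toℕ i)))
  (∑-distrib-+ {suc n} (λ i → f (toℕ i) * h (n ∸ toℕ i)) (λ i → g (toℕ i) * h (n ∸ toℕ i)))

⊛-distribˡ-+ : ∀ f g h n → (f ⊛ (λ k → g k + h k)) n ≡ (f ⊛ g) n + (f ⊛ h) n
⊛-distribˡ-+ f g h n = begin
  (f ⊛ (λ k → g k + h k)) n ≡⟨ ⊛-comm f (λ k → g k + h k) n ⟩
  ((λ k → g k + h k) ⊛ f) n ≡⟨ ⊛-distribʳ-+ g h f n ⟩
  (g ⊛ f) n + (h ⊛ f) n     ≡⟨ cong₂ _+_ (⊛-comm g f n) (⊛-comm h f n) ⟩
  (f ⊛ g) n + (f ⊛ h) n     ∎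

⊛-scaleˡ : ∀ c f g n → ((λ k → c * f k) ⊛ g) n ≡ c * (f ⊛ g) n
⊛-scaleˡ c f g n = trans
  (sum-cong-≗ {suc n} λ i → *-assoc c (f (toℕ i)) (g (n ∸ toℕ i)))
  (sym (*-distribˡ-sum {suc n} c (λ i → f (toℕ i) * g (n ∸ toℕ i))))

⊛-scaleʳ : ∀ c f g n → (f ⊛ (λ k → c * g k)) n ≡ c * (f ⊛ g) n
⊛-scaleʳ c f g n = begin
  (f ⊛ (λ k → c * g k)) n ≡⟨ ⊛-comm f (λ k → c * g k) n ⟩
  ((λ k → c * g k) ⊛ f) n ≡⟨ ⊛-scaleˡ c g f n ⟩
  c * (g ⊛ f) n           ≡⟨ cong (c *_) (⊛-comm g f n) ⟩
  c * (f ⊛ g) n           ∎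

-- Induction on the exponent: the tail of `f ⊛ g` computes to `f 0` times the tail of `g` plus
-- `(f ∘ suc) ⊛ g`, and the induction hypothesis applies to `f ∘ suc`.
⊛-assoc : ∀ f g h → ((f ⊛ g) ⊛ h) ≗ (f ⊛ (g ⊛ h))
⊛-assoc f g h zero    = lemma (f 0) (g 0) (h 0)
  where
  lemma : ∀ x y z → (x * y + 0ℚ) * z + 0ℚ ≡ x * (y * z + 0ℚ) + 0ℚ
  lemma = solve-∀ ℚ-ring
⊛-assoc f g h (suc n) = begin
  (f 0 * g 0 + 0ℚ) * h (suc n) + ((λ k → f 0 * g (suc k) + ((f ∘ suc) ⊛ g) k) ⊛ h) n
    ≡⟨ cong ((f 0 * g 0 + 0ℚ) * h (suc n) +_) (⊛-distribʳ-+ (λ k → f 0 * g (suc k)) ((f ∘ suc) ⊛ g) h n) ⟩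
  (f 0 * g 0 + 0ℚ) * h (suc n) + (((λ k → f 0 * g (suc k)) ⊛ h) n + (((f ∘ suc) ⊛ g) ⊛ h) n)
    ≡⟨ cong ((f 0 * g 0 + 0ℚ) * h (suc n) +_)
         (cong₂ _+_ (⊛-scaleˡ (f 0) (g ∘ suc) h n) (⊛-assoc (f ∘ suc) g h n)) ⟩
  (f 0 * g 0 + 0ℚ) * h (suc n) + (f 0 * ((g ∘ suc) ⊛ h) n + ((f ∘ suc) ⊛ (g ⊛ h)) n)
    ≡⟨ lemma (f 0) (g 0) (h (suc n)) (((g ∘ suc) ⊛ h) n) (((f ∘ suc) ⊛ (g ⊛ h)) n) ⟩
  f 0 * (g 0 * h (suc n) + ((g ∘ suc) ⊛ h) n) + ((f ∘ suc) ⊛ (g ⊛ h)) n ∎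
  where
  lemma : ∀ x y z u v → (x * y + 0ℚ) * z + (x * u + v) ≡ x * (y * z + u) + v
  lemma = solve-∀ ℚ-ring

⊛-left-comm : ∀ f g h → (f ⊛ (g ⊛ h)) ≗ (g ⊛ (f ⊛ h))
⊛-left-comm f g h n = begin
  (f ⊛ (g ⊛ h)) n ≡⟨ ⊛-assoc f g h n ⟨
  ((f ⊛ g) ⊛ h) n ≡⟨ ⊛-congʳ h (⊛-comm f g) n ⟩
  ((g ⊛ f) ⊛ h) n ≡⟨ ⊛-assoc g f h n ⟩
  (g ⊛ (f ⊛ h)) n ∎

0⊛ : ∀ f n → ((λ _ → 0ℚ) ⊛ f) n ≡ 0ℚ
0⊛ f zero    = cong (_+ 0ℚ) (*-zeroˡ (f 0))
0⊛ f (suc n) = cong₂ _+_ (*-zeroˡ (f (suc n))) (0⊛ f n)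

-- Serves two forms of the series 1, namely `Z ∘ suc` and `exp 0ℚ`.
const-⊛ : ∀ f g → (∀ n → f (suc n) ≡ 0ℚ) → ∀ n → (f ⊛ g) n ≡ f 0 * g n
const-⊛ f g f≡0 zero    = +-identityʳ (f 0 * g 0)
const-⊛ f g f≡0 (suc n) = begin
  f 0 * g (suc n) + ((f ∘ suc) ⊛ g) n ≡⟨ cong (f 0 * g (suc n) +_) (trans (⊛-congʳ g f≡0 n) (0⊛ g n)) ⟩
  f 0 * g (suc n) + 0ℚ                ≡⟨ +-identityʳ (f 0 * g (suc n)) ⟩
  f 0 * g (suc n)                     ∎

-- Allows a factor z to be cancelled by reading an identity at exponent n + 1.
Z⊛-suc : ∀ f n → (Z ⊛ f) (suc n) ≡ f n
Z⊛-suc f n = begin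
  0ℚ * f (suc n) + ((Z ∘ suc) ⊛ f) n ≡⟨ cong₂ _+_ (*-zeroˡ (f (suc n))) (const-⊛ (Z ∘ suc) f (λ _ → refl) n) ⟩
  0ℚ + 1ℚ * f n                      ≡⟨ +-identityˡ (1ℚ * f n) ⟩
  1ℚ * f n                           ≡⟨ *-identityˡ (f n) ⟩
  f n                                ∎

-- f(cz)
dilate : ℚ → PowerSeries → PowerSeries
dilate c f n = c ^ n * f n

dilate-⊛ : ∀ c f g n → dilate c (f ⊛ g) n ≡ (dilate c f ⊛ dilate c g) n
dilate-⊛ c f g n = begin
  c ^ n * (f ⊛ g) n
    ≡⟨ *-distribˡ-sum {suc n} (c ^ n) (λ i → f (toℕ i) * g (n ∸ toℕ i)) ⟩
  ∑[ i ≤ n ] (c ^ n * (f (toℕ i) * g (n ∸ toℕ i)))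
    ≡⟨ sum-cong-≗ {suc n} (λ i → trans
         (cong (_* (f (toℕ i) * g (n ∸ toℕ i))) (sym (^-split c (Fin.toℕ≤pred[n] i))))
         (lemma (c ^ toℕ i) (c ^ (n ∸ toℕ i)) (f (toℕ i)) (g (n ∸ toℕ i)))) ⟩
  (dilate c f ⊛ dilate c g) n ∎
  where
  lemma : ∀ u v x y → (u * v) * (x * y) ≡ (u * x) * (v * y)
  lemma = solve-∀ ℚ-ring

-- Exponential generating functions

-- By computation, `egf a n` is `a n * invFact n`.
invFact : ℕ → ℚ
invFact n = (1/ ι (n !)) {{ι-nonZero (n !) {{n ℕ.!≢0}}}}

invFact-inverseˡ : ∀ n → invFact n * ι (n !) ≡ 1ℚ
invFact-inverseˡ n = *-inverseˡ (ι (n !)) {{ι-nonZero (n !) {{n ℕ.!≢0}}}}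

nCk*k!*[n∸k]!≡n! : ∀ {n k} → k ≤ n → (n C k) ℕ.* (k ! ℕ.* (n ∸ k) !) ≡ n !
nCk*k!*[n∸k]!≡n! {n} {k} k≤n = trans
  (cong (ℕ._* (k ! ℕ.* (n ∸ k) !)) (nCk≡n!/k![n-k]! k≤n))
  (m/n*n≡m (k![n∸k]!∣n! k≤n))
  where instance _ = k ℕ.!* (n ∸ k) !≢0

-- Insert 1 = `invFact n` · n! on the left and factor n! as C(n,k) k! (n-k)!; the factorials of k
-- and n-k then cancel.
invFact-* : ∀ {n k} → k ≤ n → invFact k * invFact (n ∸ k) ≡ ι (n C k) * invFact n
invFact-* {n} {k} k≤n = begin
  u * v                       ≡⟨ *-identityʳ (u * v) ⟨
  (u * v) * 1ℚ                ≡⟨ cong ((u * v) *_) (invFact-inverseˡ n) ⟨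
  (u * v) * (w * ι (n !))     ≡⟨ cong (λ x → (u * v) * (w * x)) n!≡ ⟩
  (u * v) * (w * (c * (x * y))) ≡⟨ lemma u v w c x y ⟩
  ((u * x) * (v * y)) * (c * w) ≡⟨ cong (_* (c * w)) (cong₂ _*_ (invFact-inverseˡ k) (invFact-inverseˡ (n ∸ k))) ⟩
  1ℚ * (c * w)                ≡⟨ *-identityˡ (c * w) ⟩
  c * w                       ∎
  where
  u = invFact k
  v = invFact (n ∸ k)
  w = invFact n
  c = ι (n C k)
  x = ι (k !)
  y = ι ((n ∸ k) !)
  n!≡ : ι (n !) ≡ c * (x * y)
  n!≡ = begin
    ι (n !)                              ≡⟨ cong ι (nCk*k!*[n∸k]!≡n! k≤n) ⟨
    ι ((n C k) ℕ.* (k ! ℕ.* (n ∸ k) !))  ≡⟨ ι-homo-* (n C k) (k ! ℕ.* (n ∸ k) !) ⟩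
    c * ι (k ! ℕ.* (n ∸ k) !)            ≡⟨ cong (c *_) (ι-homo-* (k !) ((n ∸ k) !)) ⟩
    c * (x * y)                          ∎
  lemma : ∀ u v w c x y → (u * v) * (w * (c * (x * y))) ≡ ((u * x) * (v * y)) * (c * w)
  lemma = solve-∀ ℚ-ring

-- The sequence whose exponential generating function is the product of those of `a` and `b`; see
-- `egf-⊛`.
binomialConvolution : (ℕ → ℚ) → (ℕ → ℚ) → ℕ → ℚ
binomialConvolution a b n = ∑[ k ≤ n ] (ι (n C toℕ k) * (a (toℕ k) * b (n ∸ toℕ k)))

egf-⊛ : ∀ a b n → (egf a ⊛ egf b) n ≡ egf (binomialConvolution a b) n
egf-⊛ a b n = begin
  (egf a ⊛ egf b) n
    ≡⟨ sum-cong-≗ {suc n} term ⟩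
  ∑[ k ≤ n ] (ι (n C toℕ k) * (a (toℕ k) * b (n ∸ toℕ k)) * invFact n)
    ≡⟨ *-distribʳ-sum {suc n} (invFact n) (λ k → ι (n C toℕ k) * (a (toℕ k) * b (n ∸ toℕ k))) ⟨
  egf (binomialConvolution a b) n ∎
  where
  lemma₁ : ∀ x y u v → (x * u) * (y * v) ≡ (u * v) * (x * y)
  lemma₁ = solve-∀ ℚ-ring
  lemma₂ : ∀ c w x → (c * w) * x ≡ c * x * w
  lemma₂ = solve-∀ ℚ-ring
  term : ∀ (i : Fin (suc n)) → egf a (toℕ i) * egf b (n ∸ toℕ i)
       ≡ ι (n C toℕ i) * (a (toℕ i) * b (n ∸ toℕ i)) * invFact n
  term i = begin
    (a k * invFact k) * (b l * invFact l)  ≡⟨ lemma₁ (a k) (b l) (invFact k) (invFact l) ⟩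
    (invFact k * invFact l) * (a k * b l)  ≡⟨ cong (_* (a k * b l)) (invFact-* (Fin.toℕ≤pred[n] i)) ⟩
    (ι (n C k) * invFact n) * (a k * b l) ≡⟨ lemma₂ (ι (n C k)) (invFact n) (a k * b l) ⟩
    ι (n C k) * (a k * b l) * invFact n   ∎
    where
    k = toℕ i
    l = n ∸ toℕ i

-- e^{xz}
exp : ℚ → PowerSeries
exp x = egf (x ^_)

-- The binomial convolution of two sequences of powers is the binomial expansion of (x + y)^n.
exp-⊛ : ∀ x y → (exp x ⊛ exp y) ≗ exp (x + y)
exp-⊛ x y n = trans (egf-⊛ (x ^_) (y ^_) n) (cong (_* invFact n) (begin
  binomialConvolution (x ^_) (y ^_) n
    ≡⟨ sum-cong-≗ {suc n} (λ k → sym (·-ι (n C toℕ k) (x ^ toℕ k * y ^ (n ∸ toℕ k)))) ⟩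
  ∑[ k ≤ n ] ((n C toℕ k) · (x ^ toℕ k * y ^ (n ∸ toℕ k)))
    ≡⟨ binomial-theorem n x y ⟨
  (x + y) ^ n ∎))

⊛-exp-0 : ∀ f → (f ⊛ exp 0ℚ) ≗ f
⊛-exp-0 f n = begin
  (f ⊛ exp 0ℚ) n    ≡⟨ ⊛-comm f (exp 0ℚ) n ⟩
  (exp 0ℚ ⊛ f) n    ≡⟨ const-⊛ (exp 0ℚ) f exp0≡0 n ⟩
  1ℚ * f n          ≡⟨ *-identityˡ (f n) ⟩
  f n               ∎
  where
  lemma : ∀ x y → 0ℚ * x * y ≡ 0ℚ
  lemma = solve-∀ ℚ-ring
  exp0≡0 : ∀ n → exp 0ℚ (suc n) ≡ 0ℚ
  exp0≡0 n = lemma (0ℚ ^ n) (invFact (suc n))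

dilate-exp : ∀ c x → dilate c (exp x) ≗ exp (c * x)
dilate-exp c x n = begin
  c ^ n * (x ^ n * invFact n) ≡⟨ *-assoc (c ^ n) (x ^ n) (invFact n) ⟨
  c ^ n * x ^ n * invFact n   ≡⟨ cong (_* invFact n) (^-distrib-* c x n) ⟨
  exp (c * x) n            ∎

-- Sums over lists

-- Indexing by a list lets the range of summation be permuted, as `gaps-shift` requires.
sumOver : List ℕ → (ℕ → ℚ) → ℚ
sumOver xs f = foldr (λ s x → f s + x) 0ℚ xs

sumOver-cong : ∀ xs {f g} → f ≗ g → sumOver xs f ≡ sumOver xs g
sumOver-cong []       f≗g = refl
sumOver-cong (x ∷ xs) f≗g = cong₂ _+_ (f≗g x) (sumOver-cong xs f≗g)

sumOver-++ : ∀ xs ys f → sumOver (xs ++ ys) f ≡ sumOver xs f + sumOver ys f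
sumOver-++ []       ys f = sym (+-identityˡ (sumOver ys f))
sumOver-++ (x ∷ xs) ys f = trans (cong (f x +_) (sumOver-++ xs ys f))
  (sym (+-assoc (f x) (sumOver xs f) (sumOver ys f)))

sumOver-map : ∀ g xs f → sumOver (map g xs) f ≡ sumOver xs (f ∘ g)
sumOver-map g []       f = refl
sumOver-map g (x ∷ xs) f = cong (f (g x) +_) (sumOver-map g xs f)

sumOver-↭ : ∀ {xs ys} → xs ↭ ys → ∀ f → sumOver xs f ≡ sumOver ys f
sumOver-↭ Perm.refl           f = refl
sumOver-↭ (Perm.prep x xs↭ys) f = cong (f x +_) (sumOver-↭ xs↭ys f)
sumOver-↭ (Perm.swap {xs} {ys} x y xs↭ys) f = trans
  (cong (λ z → f x + (f y + z)) (sumOver-↭ xs↭ys f))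
  (lemma (f x) (f y) (sumOver ys f))
  where
  lemma : ∀ x y z → x + (y + z) ≡ y + (x + z)
  lemma = solve-∀ ℚ-ring
sumOver-↭ (Perm.trans p q)    f = trans (sumOver-↭ p f) (sumOver-↭ q f)

sumOver-+ : ∀ xs f g → sumOver xs (λ s → f s + g s) ≡ sumOver xs f + sumOver xs g
sumOver-+ []       f g = refl
sumOver-+ (x ∷ xs) f g = trans (cong (f x + g x +_) (sumOver-+ xs f g))
  (lemma (f x) (g x) (sumOver xs f) (sumOver xs g))
  where
  lemma : ∀ x y u v → x + y + (u + v) ≡ x + u + (y + v)
  lemma = solve-∀ ℚ-ring

sumOver-* : ∀ c xs f → sumOver xs (λ s → c * f s) ≡ c * sumOver xs f
sumOver-* c []       f = sym (*-zeroʳ c)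
sumOver-* c (x ∷ xs) f = trans (cong (c * f x +_) (sumOver-* c xs f))
  (sym (*-distribˡ-+ c (f x) (sumOver xs f)))

sumOver-∑ : ∀ {n} xs (f : Fin n → ℕ → ℚ) →
            sumOver xs (λ s → ∑[ i < n ] f i s) ≡ ∑[ i < n ] sumOver xs (f i)
sumOver-∑ {n} []       f = sym (sum-replicate-zero n)
sumOver-∑ {n} (x ∷ xs) f = trans (cong ((∑[ i < n ] f i x) +_) (sumOver-∑ xs f))
  (sym (∑-distrib-+ (λ i → f i x) (λ i → sumOver xs (f i))))

-- The induction splits off the last index, since `step` extends `g` at its upper end.
sumOver-telescope : ∀ (f g : ℕ → ℚ) → (∀ k → g (suc k) ≡ g k + f k) →
                    ∀ n → g 0 + sumOver (upTo n) f ≡ g n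
sumOver-telescope f g step zero    = +-identityʳ (g 0)
sumOver-telescope f g step (suc n) = begin
  g 0 + sumOver (upTo (suc n)) f              ≡⟨ cong (λ xs → g 0 + sumOver xs f) (upTo-∷ʳ n) ⟨
  g 0 + sumOver (upTo n ++ n ∷ []) f          ≡⟨ cong (g 0 +_) (sumOver-++ (upTo n) (n ∷ []) f) ⟩
  g 0 + (sumOver (upTo n) f + (f n + 0ℚ))     ≡⟨ lemma (g 0) (sumOver (upTo n) f) (f n) ⟩
  g 0 + sumOver (upTo n) f + f n              ≡⟨ cong (_+ f n) (sumOver-telescope f g step n) ⟩
  g n + f n                                   ≡⟨ step n ⟨
  g (suc n)                                   ∎
  where
  lemma : ∀ x y z → x + (y + (z + 0ℚ)) ≡ x + y + z
  lemma = solve-∀ ℚ-ring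

ι-sum-^ : ∀ j xs → ι (ℕ.sum (map (ℕ._^ j) xs)) ≡ sumOver xs (λ k → ι k ^ j)
ι-sum-^ j []       = refl
ι-sum-^ j (x ∷ xs) = trans (ι-homo-+ (x ℕ.^ j) (ℕ.sum (map (ℕ._^ j) xs)))
  (cong₂ _+_ (ι-homo-^ x j) (ι-sum-^ j xs))

powerSum-0 : ∀ n → ι (powerSum 0 n) ≡ ι n
powerSum-0 n = begin
  ι (powerSum 0 n)                      ≡⟨ ι-sum-^ 0 (upTo n) ⟩
  sumOver (upTo n) (λ _ → 1ℚ)           ≡⟨ +-identityˡ (sumOver (upTo n) (λ _ → 1ℚ)) ⟨
  0ℚ + sumOver (upTo n) (λ _ → 1ℚ)      ≡⟨ sumOver-telescope (λ _ → 1ℚ) ι ι-suc n ⟩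
  ι n                                   ∎

-- The gaps of S(p,q)

module _ (p q : ℕ) .{{_ : ℕ.NonZero p}} .{{_ : ℕ.NonZero q}} (coprime : Coprime p q) where

  private
    s+p∈ : ∀ {s} → ⟨ p , q ⟩ s → ⟨ p , q ⟩ (s ℕ.+ p)
    s+p∈ (a , b , refl) = suc a , b , lemma a b p q
      where
      lemma : ∀ a b p q → a ℕ.* p ℕ.+ b ℕ.* q ℕ.+ p ≡ (1 ℕ.+ a) ℕ.* p ℕ.+ b ℕ.* q
      lemma = ℕ.solve-∀

    gap⇒∉ : ∀ {s} → s ∈ gaps p q → ¬ ⟨ p , q ⟩ s
    gap⇒∉ {s} = Equivalence.to (∈-gaps p q coprime s)

    ∉⇒gap : ∀ {s} → ¬ ⟨ p , q ⟩ s → s ∈ gaps p q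
    ∉⇒gap {s} = Equivalence.from (∈-gaps p q coprime s)

    kq∈ : ∀ k → ⟨ p , q ⟩ (k ℕ.* q)
    kq∈ k = 0 , k , refl

    -- kq is the least element of its residue class mod p in S(p,q).
    kq≢s+p : ∀ {k s} → k < p → ⟨ p , q ⟩ s → k ℕ.* q ≢ s ℕ.+ p
    kq≢s+p {k} k<p (a , b , refl) eq = >⇒∤ k∸b<p p∣k∸b
      where
      lemma : ∀ a b p q → a ℕ.* p ℕ.+ b ℕ.* q ℕ.+ p ≡ b ℕ.* q ℕ.+ (1 ℕ.+ a) ℕ.* p
      lemma = ℕ.solve-∀
      kq≡ : k ℕ.* q ≡ b ℕ.* q ℕ.+ suc a ℕ.* p
      kq≡ = trans eq (lemma a b p q)
      bq<kq : b ℕ.* q < k ℕ.* q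
      bq<kq = subst (b ℕ.* q <_) (sym kq≡)
        (ℕ.m<m+n (b ℕ.* q) (ℕ.>-nonZero⁻¹ (suc a ℕ.* p) {{ℕ.m*n≢0 (suc a) p}}))
      b<k : b < k
      b<k = ℕ.*-cancelʳ-< q b k bq<kq
      -- Here (k - b) q = (1 + a) p, so coprimality makes p divide k - b, which lies strictly
      -- between 0 and p.
      p∣k∸b : p ∣ k ∸ b
      p∣k∸b = coprime-divisor coprime (divides (suc a) (begin
        q ℕ.* (k ∸ b)                               ≡⟨ ℕ.*-comm q (k ∸ b) ⟩
        (k ∸ b) ℕ.* q                               ≡⟨ ℕ.*-distribʳ-∸ q k b ⟩
        k ℕ.* q ∸ b ℕ.* q                           ≡⟨ cong (_∸ b ℕ.* q) kq≡ ⟩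
        b ℕ.* q ℕ.+ suc a ℕ.* p ∸ b ℕ.* q           ≡⟨ ℕ.m+n∸m≡n (b ℕ.* q) (suc a ℕ.* p) ⟩
        suc a ℕ.* p                                 ∎))
      instance _ = ℕ.>-nonZero (ℕ.m<n⇒0<n∸m b<k)
      k∸b<p : k ∸ b < p
      k∸b<p = ℕ.≤-<-trans (ℕ.m∸n≤m k b) k<p

    -- A representation with a positive coefficient of p gives up one p. Otherwise n = bq, and
    -- either b < p or p copies of q can be traded for q copies of p.
    minimal : ∀ {n} → ⟨ p , q ⟩ n →
              (∃ λ k → k < p × n ≡ k ℕ.* q) ⊎ (∃ λ s → ⟨ p , q ⟩ s × n ≡ s ℕ.+ p)
    minimal (suc a , b , refl) = inj₂ (_ , (a , b , refl) , lemma a b p q)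
      where
      lemma : ∀ a b p q → (1 ℕ.+ a) ℕ.* p ℕ.+ b ℕ.* q ≡ a ℕ.* p ℕ.+ b ℕ.* q ℕ.+ p
      lemma = ℕ.solve-∀
    minimal (zero , b , refl) with b ℕ.<? p
    ... | yes b<p = inj₁ (b , b<p , refl)
    -- The trade yields q copies of p; one of them is the summand split off, which leaves `pred q`.
    ... | no  b≮p = inj₂ (_ , (ℕ.pred q , b ∸ p , refl) , (begin
      b ℕ.* q                                  ≡⟨ cong (ℕ._* q) (ℕ.m∸n+n≡m (ℕ.≮⇒≥ b≮p)) ⟨
      (b ∸ p ℕ.+ p) ℕ.* q                      ≡⟨ cong ((b ∸ p ℕ.+ p) ℕ.*_) (ℕ.suc-pred q) ⟨
      (b ∸ p ℕ.+ p) ℕ.* suc (ℕ.pred q)         ≡⟨ lemma (b ∸ p) p (ℕ.pred q) ⟩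
      ℕ.pred q ℕ.* p ℕ.+ (b ∸ p) ℕ.* suc (ℕ.pred q) ℕ.+ p
        ≡⟨ cong (λ x → ℕ.pred q ℕ.* p ℕ.+ (b ∸ p) ℕ.* x ℕ.+ p) (ℕ.suc-pred q) ⟩
      ℕ.pred q ℕ.* p ℕ.+ (b ∸ p) ℕ.* q ℕ.+ p   ∎))
      where
      lemma : ∀ c p q → (c ℕ.+ p) ℕ.* (1 ℕ.+ q) ≡ q ℕ.* p ℕ.+ c ℕ.* (1 ℕ.+ q) ℕ.+ p
      lemma = ℕ.solve-∀

    shifted   = map (ℕ._+ p) (gaps p q)
    multiples = map (ℕ._* q) (upTo p)

    -- For n in S(p,q), either n - p is a gap or n < p. Both exclude the second case of `minimal`,
    -- so n = kq with k < p.
    to : ∀ {n} → n ∈ shifted ++ upTo p → n ∈ multiples ++ gaps p q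
    to {n} n∈ with ⟨ p , q ⟩? n | ∈-++⁻ shifted n∈
    ... | no  n∉S | _         = ∈-++⁺ʳ multiples (∉⇒gap n∉S)
    ... | yes n∈S | inj₁ n∈shifted with ∈-map⁻ (ℕ._+ p) n∈shifted
    ...   | t , t∈gaps , n≡t+p with minimal n∈S
    ...     | inj₁ (k , k<p , refl)  = ∈-++⁺ˡ (∈-map⁺ (ℕ._* q) (∈-upTo⁺ k<p))
    ...     | inj₂ (s , s∈S , n≡s+p) = contradiction
              (subst ⟨ p , q ⟩ (ℕ.+-cancelʳ-≡ p s t (trans (sym n≡s+p) n≡t+p)) s∈S) (gap⇒∉ t∈gaps)
    to {n} n∈ | yes n∈S | inj₂ n∈upTo with minimal n∈S
    ...     | inj₁ (k , k<p , refl)  = ∈-++⁺ˡ (∈-map⁺ (ℕ._* q) (∈-upTo⁺ k<p))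
    ...     | inj₂ (s , s∈S , refl) = contradiction (∈-upTo⁻ n∈upTo) (ℕ.≤⇒≯ (ℕ.m≤n+m p s))

    -- If n ≥ p, then n - p is a gap: were it in S(p,q), n could not be a gap by `s+p∈`, nor a kq
    -- with k < p by `kq≢s+p`.
    from : ∀ {n} → n ∈ multiples ++ gaps p q → n ∈ shifted ++ upTo p
    from {n} n∈ with n ℕ.<? p
    ... | yes n<p = ∈-++⁺ʳ shifted (∈-upTo⁺ n<p)
    ... | no  n≮p = ∈-++⁺ˡ (subst (_∈ shifted) n≡ (∈-map⁺ (ℕ._+ p) (∉⇒gap n∸p∉S)))
      where
      n≡ : n ∸ p ℕ.+ p ≡ n
      n≡ = ℕ.m∸n+n≡m (ℕ.≮⇒≥ n≮p)
      n∸p∉S : ¬ ⟨ p , q ⟩ (n ∸ p)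
      n∸p∉S n∸p∈S with ∈-++⁻ multiples n∈
      ... | inj₂ n∈gaps = gap⇒∉ n∈gaps (subst ⟨ p , q ⟩ n≡ (s+p∈ n∸p∈S))
      ... | inj₁ n∈multiples with ∈-map⁻ (ℕ._* q) n∈multiples
      ...   | k , k∈ , n≡kq = kq≢s+p (∈-upTo⁻ k∈) n∸p∈S (trans (sym n≡kq) (sym n≡))

    -- Shifted gaps are at least p. Once neither side has repetitions, equality of the sets of
    -- members becomes a permutation of lists.
    unique-shifted++upTo : Unique (shifted ++ upTo p)
    unique-shifted++upTo = ++⁺ (map⁺ (ℕ.+-cancelʳ-≡ p _ _) (gaps-unique p q)) (upTo⁺ p)
      λ (n∈shifted , n∈upTo) → disjoint (∈-map⁻ (ℕ._+ p) n∈shifted) (∈-upTo⁻ n∈upTo)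
      where
      disjoint : ∀ {n} → (∃ λ s → s ∈ gaps p q × n ≡ s ℕ.+ p) → ¬ n < p
      disjoint (s , _ , refl) = ℕ.≤⇒≯ (ℕ.m≤n+m p s)

    unique-multiples++gaps : Unique (multiples ++ gaps p q)
    unique-multiples++gaps = ++⁺ (map⁺ (ℕ.*-cancelʳ-≡ _ _ q) (upTo⁺ p)) (gaps-unique p q)
      λ (n∈multiples , n∈gaps) → disjoint (∈-map⁻ (ℕ._* q) n∈multiples) (gap⇒∉ n∈gaps)
      where
      disjoint : ∀ {n} → (∃ λ k → k ∈ upTo p × n ≡ k ℕ.* q) → ¬ ¬ ⟨ p , q ⟩ n
      disjoint (k , _ , refl) kq∉ = kq∉ (kq∈ k)

  -- (x^p - 1) Σ_{s ∉ S(p,q)} x^s = Σ_{k<p} x^{kq} - Σ_{c<p} x^c, without signs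
  gaps-shift : map (ℕ._+ p) (gaps p q) ++ upTo p ↭ map (ℕ._* q) (upTo p) ++ gaps p q
  gaps-shift = ∼bag⇒↭ (unique∧set⇒bag unique-shifted++upTo unique-multiples++gaps (mk⇔ to from))

-- Bernoulli series

-- z/(e^z - 1)
β : PowerSeries
β = egf bernoulli

-- β(pz)
β[_z] : ℕ → PowerSeries
β[ p z] = dilate (ι p) β

1^n≡1 : ∀ n → 1ℚ ^ n ≡ 1ℚ
1^n≡1 zero    = refl
1^n≡1 (suc n) = trans (*-identityˡ (1ℚ ^ n)) (1^n≡1 n)

exp-1+1≗exp : ∀ n → exp-1 n + exp 0ℚ n ≡ exp 1ℚ n
exp-1+1≗exp zero    = refl
exp-1+1≗exp (suc n) = trans (lemma (0ℚ ^ n) (invFact (suc n)))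
  (cong (_* invFact (suc n)) (sym (1^n≡1 (suc n))))
  where
  lemma : ∀ x y → 1ℚ * y + 0ℚ * x * y ≡ 1ℚ * y
  lemma = solve-∀ ℚ-ring

-- The equation β(z) (e^z - 1) = z without subtraction. The factor `1ℚ` gives it the shape that
-- `⊛-exp-+` expects, with c = d = 1.
β⊛exp-1 : ∀ n → (β ⊛ exp 1ℚ) n ≡ β n + 1ℚ * Z n
β⊛exp-1 n = begin
  (β ⊛ exp 1ℚ) n                       ≡⟨ ⊛-congˡ β exp-1+1≗exp n ⟨
  (β ⊛ (λ k → exp-1 k + exp 0ℚ k)) n   ≡⟨ ⊛-distribˡ-+ β exp-1 (exp 0ℚ) n ⟩
  (β ⊛ exp-1) n + (β ⊛ exp 0ℚ) n       ≡⟨ cong₂ _+_ (trans (⊛-comm β exp-1 n) (bernoulli-egf n)) (⊛-exp-0 β n) ⟩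
  Z n + β n                            ≡⟨ lemma (Z n) (β n) ⟩
  β n + 1ℚ * Z n                       ∎
  where
  lemma : ∀ x y → x + y ≡ y + 1ℚ * x
  lemma = solve-∀ ℚ-ring

dilate-Z : ∀ c n → dilate c Z n ≡ c * Z n
dilate-Z c zero          = trans (*-zeroʳ 1ℚ) (sym (*-zeroʳ c))
dilate-Z c (suc zero)    = cong (_* 1ℚ) (*-identityʳ c)
dilate-Z c (suc (suc n)) = trans (*-zeroʳ (c ^ suc (suc n))) (sym (*-zeroʳ c))

-- Substitute pz for z in `β⊛exp-1`.
β[pz]⊛exp-p : ∀ p n → (β[ p z] ⊛ exp (ι p)) n ≡ β[ p z] n + ι p * Z n
β[pz]⊛exp-p p n = begin
  (β[ p z] ⊛ exp (ι p)) n               ≡⟨ ⊛-congˡ β[ p z] (λ k → trans (dilate-exp (ι p) 1ℚ k) (cong (λ x → exp x k) (*-identityʳ (ι p)))) n ⟨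
  (β[ p z] ⊛ dilate (ι p) (exp 1ℚ)) n   ≡⟨ dilate-⊛ (ι p) β (exp 1ℚ) n ⟨
  ι p ^ n * (β ⊛ exp 1ℚ) n              ≡⟨ cong (ι p ^ n *_) (β⊛exp-1 n) ⟩
  ι p ^ n * (β n + 1ℚ * Z n)            ≡⟨ lemma (ι p ^ n) (β n) (Z n) ⟩
  β[ p z] n + dilate (ι p) Z n          ≡⟨ cong (β[ p z] n +_) (dilate-Z (ι p) n) ⟩
  β[ p z] n + ι p * Z n                 ∎
  where
  lemma : ∀ x y z → x * (y + 1ℚ * z) ≡ x * y + x * z
  lemma = solve-∀ ℚ-ring

-- The hypothesis reads f(z) (e^{dz} - 1) = cz; multiply it by e^{xz}.
⊛-exp-+ : ∀ f c d → (∀ n → (f ⊛ exp d) n ≡ f n + c * Z n) →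
          ∀ x n → (f ⊛ exp (x + d)) n ≡ (f ⊛ exp x) n + c * (Z ⊛ exp x) n
⊛-exp-+ f c d f⊛exp x n = begin
  (f ⊛ exp (x + d)) n                       ≡⟨ ⊛-congˡ f (λ k → trans (exp-⊛ d x k) (cong (λ y → exp y k) (+-comm d x))) n ⟨
  (f ⊛ (exp d ⊛ exp x)) n                   ≡⟨ ⊛-assoc f (exp d) (exp x) n ⟨
  ((f ⊛ exp d) ⊛ exp x) n                   ≡⟨ ⊛-congʳ (exp x) f⊛exp n ⟩
  ((λ k → f k + c * Z k) ⊛ exp x) n         ≡⟨ ⊛-distribʳ-+ f (λ k → c * Z k) (exp x) n ⟩
  (f ⊛ exp x) n + ((λ k → c * Z k) ⊛ exp x) n ≡⟨ cong ((f ⊛ exp x) n +_) (⊛-scaleˡ c Z (exp x) n) ⟩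
  (f ⊛ exp x) n + c * (Z ⊛ exp x) n         ∎

-- One step of the telescope: β(z) (e^{(k+1)z} - e^{kz}) = z e^{kz}, multiplied by β(pz).
β⊛β[pz]⊛exp-suc : ∀ p k n → (β ⊛ (β[ p z] ⊛ exp (ι (suc k)))) (suc n)
                ≡ (β ⊛ (β[ p z] ⊛ exp (ι k))) (suc n) + (β[ p z] ⊛ exp (ι k)) n
β⊛β[pz]⊛exp-suc p k n = begin
  (β ⊛ (b ⊛ exp (ι (suc k)))) (suc n)
    ≡⟨ ⊛-left-comm β b (exp (ι (suc k))) (suc n) ⟩
  (b ⊛ (β ⊛ exp (ι (suc k)))) (suc n)
    ≡⟨ ⊛-congˡ b (λ j → trans
         (cong (λ x → (β ⊛ exp x) j) (ι-suc k))
         (⊛-exp-+ β 1ℚ 1ℚ β⊛exp-1 (ι k) j)) (suc n) ⟩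
  (b ⊛ (λ j → (β ⊛ exp (ι k)) j + 1ℚ * (Z ⊛ exp (ι k)) j)) (suc n)
    ≡⟨ ⊛-distribˡ-+ b (β ⊛ exp (ι k)) (λ j → 1ℚ * (Z ⊛ exp (ι k)) j) (suc n) ⟩
  (b ⊛ (β ⊛ exp (ι k))) (suc n) + (b ⊛ (λ j → 1ℚ * (Z ⊛ exp (ι k)) j)) (suc n)
    ≡⟨ cong₂ _+_ (⊛-left-comm b β (exp (ι k)) (suc n))
         (⊛-congˡ b (λ j → *-identityˡ ((Z ⊛ exp (ι k)) j)) (suc n)) ⟩
  (β ⊛ (b ⊛ exp (ι k))) (suc n) + (b ⊛ (Z ⊛ exp (ι k))) (suc n)
    ≡⟨ cong ((β ⊛ (b ⊛ exp (ι k))) (suc n) +_)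
         (trans (⊛-left-comm b Z (exp (ι k)) (suc n)) (Z⊛-suc (b ⊛ exp (ι k)) n)) ⟩
  (β ⊛ (b ⊛ exp (ι k))) (suc n) + (b ⊛ exp (ι k)) n ∎
  where b = β[ p z]

-- A second evaluation of the end of the telescope: now β(pz), not β(z), absorbs e^{pz} - 1.
β⊛β[pz]⊛exp-p : ∀ p n → (β ⊛ (β[ p z] ⊛ exp (ι p))) (suc n) ≡ (β ⊛ (β[ p z] ⊛ exp 0ℚ)) (suc n) + ι p * β n
β⊛β[pz]⊛exp-p p n = begin
  (β ⊛ (b ⊛ exp (ι p))) (suc n)
    ≡⟨ ⊛-congˡ β (β[pz]⊛exp-p p) (suc n) ⟩
  (β ⊛ (λ j → b j + ι p * Z j)) (suc n)
    ≡⟨ ⊛-distribˡ-+ β b (λ j → ι p * Z j) (suc n) ⟩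
  (β ⊛ b) (suc n) + (β ⊛ (λ j → ι p * Z j)) (suc n)
    ≡⟨ cong₂ _+_ (sym (⊛-congˡ β (⊛-exp-0 b) (suc n))) (⊛-scaleʳ (ι p) β Z (suc n)) ⟩
  (β ⊛ (b ⊛ exp 0ℚ)) (suc n) + ι p * (β ⊛ Z) (suc n)
    ≡⟨ cong (λ x → (β ⊛ (b ⊛ exp 0ℚ)) (suc n) + ι p * x) (trans (⊛-comm β Z (suc n)) (Z⊛-suc β n)) ⟩
  (β ⊛ (b ⊛ exp 0ℚ)) (suc n) + ι p * β n ∎
  where b = β[ p z]

-- Multiplying Σ_{c<p} e^{cz} by z = β(z) (e^z - 1) telescopes to
-- β(z) (e^{pz} - 1), and β(pz) (e^{pz} - 1) = pz; then z is cancelled.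
sum-β[pz]⊛exp : ∀ p n → sumOver (upTo p) (λ c → (β[ p z] ⊛ exp (ι c)) n) ≡ ι p * β n
sum-β[pz]⊛exp p n = +-cancelˡ ((β ⊛ (β[ p z] ⊛ exp 0ℚ)) (suc n)) _ _ (trans
  (sumOver-telescope (λ c → (β[ p z] ⊛ exp (ι c)) n) (λ c → (β ⊛ (β[ p z] ⊛ exp (ι c))) (suc n))
    (λ c → β⊛β[pz]⊛exp-suc p c n) p)
  (β⊛β[pz]⊛exp-p p n))

-- Sum β(pz) e^{sz} over both sides of `gaps-shift`. Replacing s by s + p adds pz e^{sz}, so the sum
-- over the unshifted gaps appears on both sides and cancels.
sumOver-gaps : ∀ p q .{{_ : ℕ.NonZero p}} .{{_ : ℕ.NonZero q}} → Coprime p q → ∀ n →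
         ι p * sumOver (gaps p q) (λ s → (Z ⊛ exp (ι s)) n) + ι p * β n
         ≡ sumOver (upTo p) (λ k → (β[ p z] ⊛ exp (ι (k ℕ.* q))) n)
sumOver-gaps p q coprime n = +-cancelˡ (sumOver G φ) _ _ (begin
  sumOver G φ + (ι p * sumOver G ψ + ι p * β n)
    ≡⟨ +-assoc (sumOver G φ) (ι p * sumOver G ψ) (ι p * β n) ⟨
  sumOver G φ + ι p * sumOver G ψ + ι p * β n
    ≡⟨ cong₂ _+_ shifted (sum-β[pz]⊛exp p n) ⟨
  sumOver (map (ℕ._+ p) G) φ + sumOver (upTo p) φ
    ≡⟨ sumOver-++ (map (ℕ._+ p) G) (upTo p) φ ⟨
  sumOver (map (ℕ._+ p) G ++ upTo p) φ
    ≡⟨ sumOver-↭ (gaps-shift p q coprime) φ ⟩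
  sumOver (map (ℕ._* q) (upTo p) ++ G) φ
    ≡⟨ sumOver-++ (map (ℕ._* q) (upTo p)) G φ ⟩
  sumOver (map (ℕ._* q) (upTo p)) φ + sumOver G φ
    ≡⟨ +-comm (sumOver (map (ℕ._* q) (upTo p)) φ) (sumOver G φ) ⟩
  sumOver G φ + sumOver (map (ℕ._* q) (upTo p)) φ
    ≡⟨ cong (sumOver G φ +_) (sumOver-map (ℕ._* q) (upTo p) φ) ⟩
  sumOver G φ + sumOver (upTo p) (λ k → φ (k ℕ.* q)) ∎)
  where
  G = gaps p q
  φ ψ : ℕ → ℚ
  φ s = (β[ p z] ⊛ exp (ι s)) n
  ψ s = (Z ⊛ exp (ι s)) n
  shifted : sumOver (map (ℕ._+ p) G) φ ≡ sumOver G φ + ι p * sumOver G ψ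
  shifted = begin
    sumOver (map (ℕ._+ p) G) φ           ≡⟨ sumOver-map (ℕ._+ p) G φ ⟩
    sumOver G (λ s → φ (s ℕ.+ p))        ≡⟨ sumOver-cong G (λ s → trans
                                              (cong (λ x → (β[ p z] ⊛ exp x) n) (ι-homo-+ s p))
                                              (⊛-exp-+ β[ p z] (ι p) (ι p) (β[pz]⊛exp-p p) (ι s) n)) ⟩
    sumOver G (λ s → φ s + ι p * ψ s)    ≡⟨ sumOver-+ G φ (λ s → ι p * ψ s) ⟩
    sumOver G φ + sumOver G (λ s → ι p * ψ s) ≡⟨ cong (sumOver G φ +_) (sumOver-* (ι p) G ψ) ⟩
    sumOver G φ + ι p * sumOver G ψ      ∎

-- Comparison of the coefficients of z^m, multiplied by m!

n!*egf : ∀ a m → ι (m !) * egf a m ≡ a m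
n!*egf a m = begin
  ι (m !) * (a m * invFact m)  ≡⟨ lemma (ι (m !)) (a m) (invFact m) ⟩
  a m * (invFact m * ι (m !))  ≡⟨ cong (a m *_) (invFact-inverseˡ m) ⟩
  a m * 1ℚ                     ≡⟨ *-identityʳ (a m) ⟩
  a m                          ∎
  where
  lemma : ∀ x y z → x * (y * z) ≡ y * (z * x)
  lemma = solve-∀ ℚ-ring

n!*[Z⊛exp] : ∀ x n → ι (suc n !) * (Z ⊛ exp x) (suc n) ≡ ι (suc n) * x ^ n
n!*[Z⊛exp] x n = begin
  ι (suc n !) * (Z ⊛ exp x) (suc n)     ≡⟨ cong₂ _*_ (ι-homo-* (suc n) (n !)) (Z⊛-suc (exp x) n) ⟩
  ι (suc n) * ι (n !) * exp x n         ≡⟨ *-assoc (ι (suc n)) (ι (n !)) (exp x n) ⟩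
  ι (suc n) * (ι (n !) * exp x n)       ≡⟨ cong (ι (suc n) *_) (n!*egf (x ^_) n) ⟩
  ι (suc n) * x ^ n                     ∎

-- β(pz) is the exponential generating function of p^r B_r.
n!*[β[pz]⊛exp] : ∀ p x m → ι (m !) * (β[ p z] ⊛ exp x) m
               ≡ binomialConvolution (λ r → ι p ^ r * bernoulli r) (x ^_) m
n!*[β[pz]⊛exp] p x m = begin
  ι (m !) * (β[ p z] ⊛ exp x) m
    ≡⟨ cong (ι (m !) *_) (⊛-congʳ (exp x) (λ r → sym (*-assoc (ι p ^ r) (bernoulli r) (invFact r))) m) ⟩
  ι (m !) * (egf a ⊛ exp x) m
    ≡⟨ cong (ι (m !) *_) (egf-⊛ a (x ^_) m) ⟩
  ι (m !) * egf (binomialConvolution a (x ^_)) m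
    ≡⟨ n!*egf (binomialConvolution a (x ^_)) m ⟩
  binomialConvolution a (x ^_) m ∎
  where
  a : ℕ → ℚ
  a r = ι p ^ r * bernoulli r

-- The contribution of B_r to m! times the coefficient of z^m in β(pz) Σ_{k<p} e^{kqz}. Here p^r
-- q^{m-r} stands for q^m (p/q)^r, so that no division enters yet.
summand : ℕ → ℕ → ℕ → ℕ → ℚ
summand p q m r = ι (m C r) * (ι p ^ r * bernoulli r) * ι q ^ (m ∸ r) * ι (powerSum (m ∸ r) p)

-- Exchange the sums over k and r; as (kq)^{m-r} = k^{m-r} q^{m-r}, the inner sum over k is
-- S_{m-r}(p).
sum-β[pz] : ∀ p q m → ι (m !) * sumOver (upTo p) (λ k → (β[ p z] ⊛ exp (ι (k ℕ.* q))) m)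
          ≡ ∑[ r ≤ m ] summand p q m (toℕ r)
sum-β[pz] p q m = begin
  ι (m !) * sumOver (upTo p) (λ k → (β[ p z] ⊛ exp (ι (k ℕ.* q))) m)
    ≡⟨ sumOver-* (ι (m !)) (upTo p) (λ k → (β[ p z] ⊛ exp (ι (k ℕ.* q))) m) ⟨
  sumOver (upTo p) (λ k → ι (m !) * (β[ p z] ⊛ exp (ι (k ℕ.* q))) m)
    ≡⟨ sumOver-cong (upTo p) (λ k → n!*[β[pz]⊛exp] p (ι (k ℕ.* q)) m) ⟩
  sumOver (upTo p) (λ k → ∑[ r ≤ m ] (c (toℕ r) * (a (toℕ r) * ι (k ℕ.* q) ^ (m ∸ toℕ r))))
    ≡⟨ sumOver-∑ {suc m} (upTo p) (λ r k → c (toℕ r) * (a (toℕ r) * ι (k ℕ.* q) ^ (m ∸ toℕ r))) ⟩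
  ∑[ r ≤ m ] sumOver (upTo p) (λ k → c (toℕ r) * (a (toℕ r) * ι (k ℕ.* q) ^ (m ∸ toℕ r)))
    ≡⟨ sum-cong-≗ {suc m} (λ r → term (toℕ r)) ⟩
  ∑[ r ≤ m ] summand p q m (toℕ r) ∎
  where
  a c : ℕ → ℚ
  a r = ι p ^ r * bernoulli r
  c r = ι (m C r)
  lemma : ∀ c a x y → c * (a * (x * y)) ≡ c * a * y * x
  lemma = solve-∀ ℚ-ring
  term : ∀ r → sumOver (upTo p) (λ k → c r * (a r * ι (k ℕ.* q) ^ (m ∸ r))) ≡ summand p q m r
  term r = begin
    sumOver (upTo p) (λ k → c r * (a r * ι (k ℕ.* q) ^ (m ∸ r)))
      ≡⟨ sumOver-cong (upTo p) (λ k → trans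
           (cong (λ x → c r * (a r * x)) (trans (cong (_^ (m ∸ r)) (ι-homo-* k q)) (^-distrib-* (ι k) (ι q) (m ∸ r))))
           (lemma (c r) (a r) (ι k ^ (m ∸ r)) (ι q ^ (m ∸ r)))) ⟩
    sumOver (upTo p) (λ k → c r * a r * ι q ^ (m ∸ r) * ι k ^ (m ∸ r))
      ≡⟨ sumOver-* (c r * a r * ι q ^ (m ∸ r)) (upTo p) (λ k → ι k ^ (m ∸ r)) ⟩
    c r * a r * ι q ^ (m ∸ r) * sumOver (upTo p) (λ k → ι k ^ (m ∸ r))
      ≡⟨ cong (c r * a r * ι q ^ (m ∸ r) *_) (ι-sum-^ (m ∸ r) (upTo p)) ⟨
    summand p q m r ∎

summand-top : ∀ p q m → summand p q m m ≡ ι p ^ m * bernoulli m * ι p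
-- The last factor p is S_0(p), in which k = 0 counts because 0^0 = 1.
summand-top p q m rewrite nCn≡1 m | ℕ.n∸n≡0 m | powerSum-0 p = lemma (ι p ^ m * bernoulli m) (ι p)
  where
  lemma : ∀ x y → 1ℚ * x * 1ℚ * y ≡ x * y
  lemma = solve-∀ ℚ-ring

÷-*-cancel : ∀ x y .{{_ : NonZero y}} → (x ÷ y) * y ≡ x
÷-*-cancel x y = begin
  x * 1/ y * y    ≡⟨ *-assoc x (1/ y) y ⟩
  x * (1/ y * y)  ≡⟨ cong (x *_) (*-inverseˡ y) ⟩
  x * 1ℚ          ≡⟨ *-identityʳ x ⟩
  x               ∎

-- Write p^r = (p/q)^r q^r and merge q^r with q^{m-r}.
summand-q^m : ∀ p q m r .{{_ : NonZero (ι q)}} → r ≤ m → summand p q m r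
            ≡ ι q ^ m * (ι (m C r) * (ι p ÷ ι q) ^ r * bernoulli r * ι (powerSum (m ∸ r) p))
summand-q^m p q m r r≤m = begin
  c * (ι p ^ r * b) * ι q ^ (m ∸ r) * s
    ≡⟨ cong (λ x → c * (x * b) * ι q ^ (m ∸ r) * s) (trans (cong (_^ r) (sym (÷-*-cancel (ι p) (ι q)))) (^-distrib-* (ι p ÷ ι q) (ι q) r)) ⟩
  c * (t * ι q ^ r * b) * ι q ^ (m ∸ r) * s
    ≡⟨ lemma c t (ι q ^ r) b (ι q ^ (m ∸ r)) s ⟩
  (ι q ^ r * ι q ^ (m ∸ r)) * (c * t * b * s)
    ≡⟨ cong (_* (c * t * b * s)) (^-split (ι q) r≤m) ⟩
  ι q ^ m * (c * t * b * s) ∎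
  where
  c = ι (m C r)
  b = bernoulli r
  s = ι (powerSum (m ∸ r) p)
  t = (ι p ÷ ι q) ^ r
  lemma : ∀ c t x b y s → c * (t * x * b) * y * s ≡ (x * y) * (c * t * b * s)
  lemma = solve-∀ ℚ-ring

-- The term r = m, which contains B_m itself, is separated so that B_m can be solved for.
sum-summand : ∀ p q m .{{_ : NonZero (ι q)}} → ∑[ r ≤ m ] summand p q m (toℕ r)
            ≡ ι q ^ m * ∑[ r < m ] (ι (m C toℕ r) * (ι p ÷ ι q) ^ toℕ r * bernoulli (toℕ r) * ι (powerSum (m ∸ toℕ r) p))
              + ι p ^ m * bernoulli m * ι p
sum-summand p q m = begin
  ∑[ r ≤ m ] summand p q m (toℕ r)
    ≡⟨ sum-init-last {m} (λ r → summand p q m (toℕ r)) ⟩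
  (∑[ r < m ] summand p q m (toℕ (inject₁ r))) + summand p q m (toℕ (fromℕ m))
    ≡⟨ cong₂ _+_
         (sum-cong-≗ {m} λ r → trans (cong (summand p q m) (Fin.toℕ-inject₁ r)) (summand-q^m p q m (toℕ r) (ℕ.<⇒≤ (Fin.toℕ<n r))))
         (trans (cong (summand p q m) (Fin.toℕ-fromℕ m)) (summand-top p q m)) ⟩
  (∑[ r < m ] (ι q ^ m * u r)) + ι p ^ m * bernoulli m * ι p
    ≡⟨ cong (_+ ι p ^ m * bernoulli m * ι p) (*-distribˡ-sum {m} (ι q ^ m) u) ⟨
  ι q ^ m * (∑[ r < m ] u r) + ι p ^ m * bernoulli m * ι p ∎
  where
  u : Fin m → ℚ
  u r = ι (m C toℕ r) * (ι p ÷ ι q) ^ toℕ r * bernoulli (toℕ r) * ι (powerSum (m ∸ toℕ r) p)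

n!*sum-gaps : ∀ p q n → ι (suc n !) * sumOver (gaps p q) (λ s → (Z ⊛ exp (ι s)) (suc n))
            ≡ ι (suc n) * ι (sylvesterSum n p q)
n!*sum-gaps p q n = begin
  ι (suc n !) * sumOver G (λ s → (Z ⊛ exp (ι s)) (suc n))
    ≡⟨ sumOver-* (ι (suc n !)) G (λ s → (Z ⊛ exp (ι s)) (suc n)) ⟨
  sumOver G (λ s → ι (suc n !) * (Z ⊛ exp (ι s)) (suc n))
    ≡⟨ sumOver-cong G (λ s → n!*[Z⊛exp] (ι s) n) ⟩
  sumOver G (λ s → ι (suc n) * ι s ^ n)
    ≡⟨ sumOver-* (ι (suc n)) G (λ s → ι s ^ n) ⟩
  ι (suc n) * sumOver G (λ s → ι s ^ n)
    ≡⟨ cong (ι (suc n) *_) (ι-sum-^ n G) ⟨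
  ι (suc n) * ι (sylvesterSum n p q) ∎
  where G = gaps p q

sylvester-bernoulli : ∀ p q n .{{_ : ℕ.NonZero p}} .{{_ : ℕ.NonZero q}} → Coprime p q →
  ι p * (ι (suc n) * ι (sylvesterSum n p q)) + ι p * bernoulli (suc n)
  ≡ ∑[ r ≤ suc n ] summand p q (suc n) (toℕ r)
sylvester-bernoulli p q n coprime = begin
  ι p * (ι (suc n) * ι (sylvesterSum n p q)) + ι p * bernoulli (suc n)
    ≡⟨ cong₂ (λ x y → ι p * x + ι p * y) (n!*sum-gaps p q n) (n!*egf bernoulli (suc n)) ⟨
  ι p * (f * s) + ι p * (f * β (suc n))
    ≡⟨ lemma (ι p) f s (β (suc n)) ⟩
  f * (ι p * s + ι p * β (suc n))
    ≡⟨ cong (f *_) (sumOver-gaps p q coprime (suc n)) ⟩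
  f * sumOver (upTo p) (λ k → (β[ p z] ⊛ exp (ι (k ℕ.* q))) (suc n))
    ≡⟨ sum-β[pz] p q (suc n) ⟩
  ∑[ r ≤ suc n ] summand p q (suc n) (toℕ r) ∎
  where
  f = ι (suc n !)
  s = sumOver (gaps p q) (λ s → (Z ⊛ exp (ι s)) (suc n))
  lemma : ∀ p f s b → p * (f * s) + p * (f * b) ≡ f * (p * s + p * b)
  lemma = solve-∀ ℚ-ring

-- Collecting the terms in B gives p (1 - P) B = Q V - p M S. Division turns the last term into M S
-- / (P - 1), which accounts for its sign.
solve-for-bernoulli : ∀ B M S Q V p P .{{_ : NonZero (P - 1ℚ)}} .{{_ : NonZero (p * (1ℚ - P))}} →
              p * (M * S) + p * B ≡ Q * V + P * B * p →
              B ≡ (M ÷ (P - 1ℚ)) * S + (Q ÷ (p * (1ℚ - P))) * V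
solve-for-bernoulli B M S Q V p P eq = sym (begin
  M * d * S + Q * e * V
    -- Adding and subtracting P B p exposes the right-hand side of `eq`.
    ≡⟨ lemma₁ M d S Q e V P B p ⟩
  M * d * S + e * ((Q * V + P * B * p) - P * B * p)
    ≡⟨ cong (λ x → M * d * S + e * (x - P * B * p)) eq ⟨
  M * d * S + e * ((p * (M * S) + p * B) - P * B * p)
    ≡⟨ lemma₂ M d S e p B P ⟩
  M * S * (d + e * p) + B * (e * (p * (1ℚ - P)))
    ≡⟨ cong₂ (λ x y → M * S * x + B * y) d+ep≡0 e-inverse ⟩
  M * S * 0ℚ + B * 1ℚ
    ≡⟨ lemma₃ (M * S) B ⟩
  B ∎)
  where
  d e : ℚ
  d = 1/ (P - 1ℚ)
  e = 1/ (p * (1ℚ - P))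
  e-inverse : e * (p * (1ℚ - P)) ≡ 1ℚ
  e-inverse = *-inverseˡ (p * (1ℚ - P))
  lemma₁ : ∀ M d S Q e V P B p → M * d * S + Q * e * V ≡ M * d * S + e * ((Q * V + P * B * p) - P * B * p)
  lemma₁ = solve-∀ ℚ-ring
  lemma₂ : ∀ M d S e p B P → M * d * S + e * ((p * (M * S) + p * B) - P * B * p)
         ≡ M * S * (d + e * p) + B * (e * (p * (1ℚ - P)))
  lemma₂ = solve-∀ ℚ-ring
  lemma₃ : ∀ x y → x * 0ℚ + y * 1ℚ ≡ y
  lemma₃ = solve-∀ ℚ-ring
  lemma₄ : ∀ d e p → d + e * p ≡ d * 1ℚ + e * p * 1ℚ
  lemma₄ = solve-∀ ℚ-ring
  lemma₅ : ∀ d e p P → d * (e * (p * (1ℚ - P))) + e * p * (d * (P - 1ℚ)) ≡ 0ℚ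
  lemma₅ = solve-∀ ℚ-ring
  -- Each term is multiplied by the other inverse's defining product, equal to 1; the resulting
  -- polynomial in d, e, p, P vanishes identically.
  d+ep≡0 : d + e * p ≡ 0ℚ
  d+ep≡0 = begin
    d + e * p                                             ≡⟨ lemma₄ d e p ⟩
    d * 1ℚ + e * p * 1ℚ                                   ≡⟨ cong₂ (λ x y → d * x + e * p * y) e-inverse (*-inverseˡ (P - 1ℚ)) ⟨
    d * (e * (p * (1ℚ - P))) + e * p * (d * (P - 1ℚ))     ≡⟨ lemma₅ d e p P ⟩
    0ℚ                                                    ∎

mainTheorem3 :
    (p q m : ℕ) (1<p : 1 < p) (1<q : 1 < q) → Coprime p q → (1≤m : 1 ≤ m) →
    let instance
          q≢0         = 1<n⇒ι-nonZero 1<q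
          p^m-1≢0     = p^m-1-nonZero 1<p 1≤m
          p[1-p^m]≢0  = p[1-p^m]-nonZero 1<p 1≤m
    in
    bernoulli m ≡
      (ι m ÷ (ι p ^ m - 1ℚ)) * ι (sylvesterSum (m ∸ 1) p q) +
      (ι q ^ m ÷ (ι p * (1ℚ - ι p ^ m))) *
        ∑[ r < m ] (ι (m C toℕ r) * (ι p ÷ ι q) ^ toℕ r * bernoulli (toℕ r) * ι (powerSum (m ∸ toℕ r) p))
mainTheorem3 p q (suc n) 1<p 1<q coprime 1≤m =
  -- As m = n + 1, the exponent m - 1 of the Sylvester sum computes to n.
  solve-for-bernoulli _ (ι (suc n)) (ι (sylvesterSum n p q)) (ι q ^ suc n) _ (ι p) (ι p ^ suc n)
    (trans (sylvester-bernoulli p q n coprime) (sum-summand p q (suc n)))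
  where
  instance
    _ = ℕ.>-nonZero (ℕ.<-trans (s≤s z≤n) 1<p)
    _ = ℕ.>-nonZero (ℕ.<-trans (s≤s z≤n) 1<q)
    _ = 1<n⇒ι-nonZero 1<q
    _ = p^m-1-nonZero 1<p 1≤m
    _ = p[1-p^m]-nonZero 1<p 1≤m
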